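{- For every $d \in \{2,3,4,5,8,12,16,17,24,32,40,48,80,112\}$, the sequence $\left(\left\lfloor n^8/d \right\rfloor\right)_{n \ge 1}$ is eventually prime-free.
   Context: A sequence $(a_n)_{n\ge 1}$ of positive integers is called eventually prime-free if there exists an index $n_0$ such that $a_n$ is composite for all $n \ge n_0$. (Here, as in the paper, this is understood as: only finitely many terms $a_n$ are prime.) -}

module Defs where

open import Data.Nat using (ℕ; _≤_)
open import Data.Nat.Primality using (Prime; Composite; composite⇒¬prime)
open import Data.Product using (∃-syntax; _×_; _,_)
open import Relation.Nullary using (¬_)

-- A sequence (a_n)_{n ≥ 1} is given by a function on ℕ whose value at 0 is
-- irrelevant; accordingly the index n₀ is required to be at least 1.
EventuallyPrimeFree : (ℕ → ℕ) → Set
EventuallyPrimeFree a = ∃[ n₀ ] (1 ≤ n₀ × (∀ n → n₀ ≤ n → Composite (a n)))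

-- Only finitely many terms are prime: all indices of prime terms lie below n₀.
eventuallyPrimeFree⇒finitelyManyPrimes :
  ∀ {a} → EventuallyPrimeFree a → ∃[ n₀ ] (∀ n → n₀ ≤ n → ¬ Prime (a n))
eventuallyPrimeFree⇒finitelyManyPrimes (n₀ , _ , composite) =
  n₀ , λ n n₀≤n → composite⇒¬prime (composite n n₀≤n)

{-# OPTIONS --safe #-}
-- Write n⁸ = q d + r with r = n⁸ mod d. If r = s² is a square, then
-- q d = (n⁴ − s)(n⁴ + s) with both factors exceeding d for large n, which
-- forces q to be composite. The parity of q depends only on n mod 2d, and for
-- each listed d every residue class modulo 2d whose r is not a square makes
-- q even.
module Submission where

open import Data.Nat using (ℕ; zero; suc; _+_; _*_; _∸_; _^_; _/_; _%_; _≤_; _<_; z≤n; s≤s; NonZero; >-nonZero; >-nonZero⁻¹; n>1⇒nonTrivial)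
open import Data.Nat.Properties
open import Data.Nat.Divisibility using (_∣_; divides; n∣m*n; m%n≡0⇒n∣m; ∣⇒≤)
open import Data.Nat.DivMod using (m≡m%n+[m/n]*n; m%n<n; m%n%n≡m%n; %-distribˡ-*; m∣n⇒o%n%m≡o%m; m%[n*o]/o≡m/o%n; m*n/n≡m; /-monoˡ-≤)
open import Data.Nat.Primality using (Prime; Composite; composite; euclidsLemma; ¬prime⇒composite)
open import Data.Nat.Tactic.RingSolver using (solve-∀)
open import Data.List using (List; _∷_; [])
open import Data.List.Membership.Propositional using (_∈_)
open import Data.List.Relation.Unary.All using (All; _∷_; []; lookup)
open import Data.Product using (∃-syntax; _×_; _,_)
open import Data.Sum using (_⊎_; inj₁; inj₂)
open import Relation.Nullary using (¬_; Dec; from-yes; _⊎-dec_)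
open import Relation.Binary.PropositionalEquality using (_≡_; refl; sym; trans; cong; cong₂; subst; module ≡-Reasoning)
open import Defs

[m%d]^k%d≡m^k%d : ∀ m k d .{{_ : NonZero d}} → (m % d) ^ k % d ≡ m ^ k % d
[m%d]^k%d≡m^k%d m zero    d = refl
[m%d]^k%d≡m^k%d m (suc k) d = begin
  (m % d) * (m % d) ^ k % d                ≡⟨ %-distribˡ-* (m % d) ((m % d) ^ k) d ⟩
  (m % d % d) * ((m % d) ^ k % d) % d      ≡⟨ cong₂ (λ x y → x * y % d) (m%n%n≡m%n m d) ([m%d]^k%d≡m^k%d m k d) ⟩
  (m % d) * (m ^ k % d) % d                ≡⟨ %-distribˡ-* m (m ^ k) d ⟨
  m * m ^ k % d                            ∎
  where open ≡-Reasoning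

p∣a∧ab≡pd⇒b≤d : ∀ {p a b d} .{{_ : NonZero p}} .{{_ : NonZero a}} →
                p ∣ a → a * b ≡ p * d → b ≤ d
p∣a∧ab≡pd⇒b≤d {p} {a} {b} {d} p∣a ab≡pd = *-cancelˡ-≤ p (begin
  p * b  ≤⟨ *-monoˡ-≤ b (∣⇒≤ p∣a) ⟩
  a * b  ≡⟨ ab≡pd ⟩
  p * d  ∎)
  where open ≤-Reasoning

-- A prime `q` would divide `a` or `b`. If it divides `a`, then `q ≤ a`, and cancelling `q` from
-- `q * b ≤ a * b ≡ q * d` gives `b ≤ d`, a contradiction; the other case is symmetric.
composite-cofactor : ∀ {q a b d} → 1 < q → d < a → d < b → a * b ≡ q * d → Composite q
composite-cofactor {q} {a} {b} {d} 1<q d<a d<b ab≡qd =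
  ¬prime⇒composite {{n>1⇒nonTrivial 1<q}} ¬prime
  where
  instance
    q≢0 : NonZero q
    q≢0 = >-nonZero (<-trans (s≤s z≤n) 1<q)
    a≢0 : NonZero a
    a≢0 = >-nonZero (≤-<-trans z≤n d<a)
    b≢0 : NonZero b
    b≢0 = >-nonZero (≤-<-trans z≤n d<b)
  ¬prime : ¬ Prime q
  ¬prime pq with euclidsLemma a b pq (divides d (trans ab≡qd (*-comm q d)))
  ... | inj₁ q∣a = <⇒≱ d<b (p∣a∧ab≡pd⇒b≤d q∣a ab≡qd)
  ... | inj₂ q∣b = <⇒≱ d<a (p∣a∧ab≡pd⇒b≤d q∣b (trans (*-comm b a) ab≡qd))

-- The bound `s < d` loses nothing, since `s ≤ s * s ≡ m % d < d`. It makes the search for `s`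
-- finite and keeps `m ∸ s` above `d` once `m` is at least `2d`.
SquareRemainder : (d m : ℕ) .{{_ : NonZero d}} → Set
SquareRemainder d m = ∃[ s ] (s < d × s * s ≡ m % d)

composite-square : ∀ {d m} .{{_ : NonZero d}} → 1 < (m * m) / d → d + d ≤ m →
                   SquareRemainder d (m * m) → Composite ((m * m) / d)
composite-square {d} {m} 1<q 2d≤m (s , s<d , s²≡r) =
  composite-cofactor 1<q d<m∸s (<-≤-trans d<m (m≤m+n m s)) (+-cancelˡ-≡ (s * s) _ _ (begin
    s * s + (m ∸ s) * (m + s)              ≡⟨ cong (λ x → s * s + (m ∸ s) * (x + s)) s+t≡m ⟨
    s * s + (m ∸ s) * (s + (m ∸ s) + s)    ≡⟨ identity s (m ∸ s) ⟩
    (s + (m ∸ s)) * (s + (m ∸ s))          ≡⟨ cong (λ x → x * x) s+t≡m ⟩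
    m * m                                  ≡⟨ m≡m%n+[m/n]*n (m * m) d ⟩
    (m * m) % d + (m * m) / d * d          ≡⟨ cong (_+ (m * m) / d * d) s²≡r ⟨
    s * s + (m * m) / d * d                ∎))
  where
  open ≡-Reasoning
  s+d<m : s + d < m
  s+d<m = <-≤-trans (+-monoˡ-< d s<d) 2d≤m
  d<m : d < m
  d<m = ≤-<-trans (m≤n+m d s) s+d<m
  s+t≡m : s + (m ∸ s) ≡ m
  s+t≡m = m+[n∸m]≡n (≤-trans (m≤m+n s d) (<⇒≤ s+d<m))
  d<m∸s : d < m ∸ s
  d<m∸s = +-cancelˡ-< s d (m ∸ s) (subst (s + d <_) (sym s+t≡m) s+d<m)
  identity : ∀ s t → s * s + t * (s + t + s) ≡ (s + t) * (s + t)
  identity = solve-∀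

SquareOrEven : (d m : ℕ) .{{_ : NonZero d}} → Set
SquareOrEven d m = SquareRemainder d m ⊎ (m / d) % 2 ≡ 0

squareOrEven? : ∀ d m .{{_ : NonZero d}} → Dec (SquareOrEven d m)
squareOrEven? d m = anyUpTo? (λ s → s * s ≟ m % d) d ⊎-dec ((m / d) % 2 ≟ 0)

-- Both alternatives depend only on the residue modulo `2 * d`: reducing it modulo `d` gives the
-- remainder, and dividing it by `d` gives the parity of the quotient.
squareOrEven-% : ∀ {d m n} .{{_ : NonZero d}} {{_ : NonZero (2 * d)}} →
                 m % (2 * d) ≡ n % (2 * d) → SquareOrEven d m → SquareOrEven d n
squareOrEven-% {d} {m} {n} m≡n (inj₁ (s , s<d , s²≡r)) = inj₁ (s , s<d , (begin
  s * s            ≡⟨ s²≡r ⟩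
  m % d            ≡⟨ m∣n⇒o%n%m≡o%m d (2 * d) m (n∣m*n 2) ⟨
  m % (2 * d) % d  ≡⟨ cong (_% d) m≡n ⟩
  n % (2 * d) % d  ≡⟨ m∣n⇒o%n%m≡o%m d (2 * d) n (n∣m*n 2) ⟩
  n % d            ∎))
  where open ≡-Reasoning
squareOrEven-% {d} {m} {n} m≡n (inj₂ even) = inj₂ (begin
  n / d % 2        ≡⟨ m%[n*o]/o≡m/o%n n 2 d ⟨
  n % (2 * d) / d  ≡⟨ cong (_/ d) m≡n ⟨
  m % (2 * d) / d  ≡⟨ m%[n*o]/o≡m/o%n m 2 d ⟩
  m / d % 2        ≡⟨ even ⟩
  0                ∎)
  where open ≡-Reasoning

eventuallyPrimeFree-^8 : ∀ d .{{_ : NonZero d}} →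
                         (∀ {c} → c < 2 * d → SquareOrEven d (c ^ 8)) →
                         EventuallyPrimeFree (λ n → n ^ 8 / d)
eventuallyPrimeFree-^8 d residues =
  -- The threshold `3 * d` serves two purposes: it gives `n ≥ 3`, from which the quotient exceeds 2,
  -- and `n ^ 4 ≥ n ≥ 2d`, as the square case requires.
  3 * d , ≤-trans (s≤s z≤n) (*-monoʳ-≤ 3 1≤d) , λ n 3d≤n → composite-n n 3d≤n
    -- The representative checked is `c = n % (2 * d)`, whose eighth power is congruent to `n ^ 8`.
    (squareOrEven-% ([m%d]^k%d≡m^k%d n 8 (2 * d)) (residues (m%n<n n (2 * d))))
  where
  instance
    2d≢0 : NonZero (2 * d)
    2d≢0 = m*n≢0 2 d
  1≤d : 1 ≤ d
  1≤d = >-nonZero⁻¹ d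

  composite-n : ∀ n → 3 * d ≤ n → SquareOrEven d (n ^ 8) → Composite (n ^ 8 / d)
  composite-n n 3d≤n = λ where
      (inj₁ square) → subst (λ x → Composite (x / d)) n⁸≡
        (composite-square
          (subst (λ x → 1 < x / d) (sym n⁸≡) (<⇒≤ 2<q))
          2d≤n⁴
          (subst (λ x → SquareRemainder d x) (sym n⁸≡) square))
      -- An even quotient is composite only if 2 is a proper divisor, hence the strict bound `2<q`.
      (inj₂ even) → composite 2<q (m%n≡0⇒n∣m (n ^ 8 / d) 2 even)
    where
    open ≤-Reasoning
    3≤n : 3 ≤ n
    3≤n = ≤-trans (*-monoʳ-≤ 3 1≤d) 3d≤n
    instance
      n≢0 : NonZero n
      n≢0 = >-nonZero (≤-trans (s≤s z≤n) 3≤n)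
    n⁸≡ : n ^ 4 * n ^ 4 ≡ n ^ 8
    n⁸≡ = sym (^-distribˡ-+-* n 4 4)
    2d≤n⁴ : d + d ≤ n ^ 4
    2d≤n⁴ = begin
      d + d  ≤⟨ +-monoʳ-≤ d (m≤m+n d _) ⟩
      3 * d  ≤⟨ 3d≤n ⟩
      n      ≤⟨ m≤m*n n (n ^ 3) {{m^n≢0 n 3}} ⟩
      n ^ 4  ∎
    2<q : 2 < n ^ 8 / d
    2<q = begin
      3           ≤⟨ 3≤n ⟩
      n           ≡⟨ m*n/n≡m n d ⟨
      -- Since `n ^ 7 ≥ d`, one factor `n` of `n ^ 8` survives the division.
      n * d / d   ≤⟨ /-monoˡ-≤ d (*-monoʳ-≤ n (begin
                       d           ≤⟨ m≤m+n d _ ⟩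
                       3 * d       ≤⟨ 3d≤n ⟩
                       n           ≤⟨ m≤m*n n (n ^ 6) {{m^n≢0 n 6}} ⟩
                       n ^ 7       ∎)) ⟩
      n ^ 8 / d   ∎

residues? : ∀ d .{{_ : NonZero d}} →
              Dec (∀ {c} → c < 2 * d → SquareOrEven d (c ^ 8))
residues? d = allUpTo? (λ c → squareOrEven? d (c ^ 8)) (2 * d)

theorem5 : (d : ℕ) .{{_ : NonZero d}} →
    d ∈ (2 ∷ 3 ∷ 4 ∷ 5 ∷ 8 ∷ 12 ∷ 16 ∷ 17 ∷ 24 ∷ 32 ∷ 40 ∷ 48 ∷ 80 ∷ 112 ∷ []) →
    EventuallyPrimeFree (λ n → n ^ 8 / d)
theorem5 d d∈ = eventuallyPrimeFree-^8 d (lookup residues d∈)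
  where
  -- `NonZero d` is a premise inside the predicate, so it is resolved at each numeral, while
  -- `lookup` still yields the property for the variable `d`.
  residues : All (λ d → .{{_ : NonZero d}} → ∀ {c} → c < 2 * d → SquareOrEven d (c ^ 8))
                 (2 ∷ 3 ∷ 4 ∷ 5 ∷ 8 ∷ 12 ∷ 16 ∷ 17 ∷ 24 ∷ 32 ∷ 40 ∷ 48 ∷ 80 ∷ 112 ∷ [])
  residues =
    -- Each `from-yes` type-checks only if the decision evaluates to yes, so all residues modulo
    -- `2 * d` are checked by computation.
    from-yes (residues? 2) ∷ from-yes (residues? 3) ∷ from-yes (residues? 4)
    ∷ from-yes (residues? 5) ∷ from-yes (residues? 8) ∷ from-yes (residues? 12)
    ∷ from-yes (residues? 16) ∷ from-yes (residues? 17) ∷ from-yes (residues? 24)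
    ∷ from-yes (residues? 32) ∷ from-yes (residues? 40) ∷ from-yes (residues? 48)
    ∷ from-yes (residues? 80) ∷ from-yes (residues? 112) ∷ []
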